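{- For every integer $k\ge 1$, $|I_k(132,321)|$ is equal to the number of partitions of $k$ in which all parts are equal, and this is in turn equal to the number of positive divisors of $k$.
   Context: A permutation of length $n$ is a word $\pi=\pi_1\cdots\pi_n$ containing each of $1,\dots,n$ exactly once. The sum of permutations $\rho=\rho_1\cdots\rho_n$ and $\tau=\tau_1\cdots\tau_m$ is the permutation $\rho\oplus\tau=\rho_1\cdots\rho_n(n+\tau_1)\cdots(n+\tau_m)$ of length $n+m$. A permutation is decomposable if it equals $\rho\oplus\tau$ for some non-empty permutations $\rho,\tau$; a non-empty permutation that is not decomposable is indecomposable. An inversion of $\pi$ is a pair $(i,j)$ with $i<j$ and $\pi_i>\pi_j$. A permutation $\pi$ contains a permutation (pattern) $\tau=\tau_1\cdots\tau_m$ if there are indices $i_1<\dots<i_m$ such that $\pi_{i_1},\dots,\pi_{i_m}$ is order-isomorphic to $\tau_1,\dots,\tau_m$; otherwise $\pi$ avoids $\tau$. $I_k(\tau_1,\dots,\tau_r)$ denotes the (finite) set of all indecomposable permutations, of any length, with exactly $k$ inversions that avoid all of $\tau_1,\dots,\tau_r$. -}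

module Defs where

open import Level using (0ℓ)
open import Data.Fin.Base as Fin using (Fin)
import Data.Fin.Properties as Fin
open import Data.List.Base using (List; []; _∷_; _++_; map; length; lookup; filter; allFin; applyUpTo; cartesianProduct)
open import Data.List.Membership.Propositional using (_∈_)
open import Data.List.Relation.Binary.Permutation.Propositional using (_↭_)
open import Data.List.Relation.Unary.All using (All)
open import Data.List.Relation.Unary.AllPairs using (AllPairs)
open import Data.List.Relation.Unary.Linked using (Linked)
open import Data.List.Relation.Unary.Unique.Propositional using (Unique)
open import Data.Nat.Base using (ℕ; suc; _+_; _<_; _>_; _≥_)
open import Data.Nat.Divisibility using (_∣_)
open import Data.Nat.ListAction using (sum)
open import Data.Nat.Properties using (_<?_)
open import Data.Product using (_×_; _,_; ∃-syntax; Σ-syntax)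
open import Function.Bundles using (_⇔_)
open import Relation.Binary.PropositionalEquality using (_≡_; _≢_)
open import Relation.Nullary using (¬_)
open import Relation.Nullary.Decidable using (_×-dec_)
open import Relation.Unary using (Pred; Decidable)

-- The subset P of A is finite with exactly n elements: some
-- repetition-free list of length n has precisely the elements of P.
HasCardinality : {A : Set} → Pred A 0ℓ → ℕ → Set
HasCardinality {A} P n =
  ∃[ xs ] Unique xs × (∀ (x : A) → x ∈ xs ⇔ P x) × length xs ≡ n

Word : Set
Word = List ℕ

-- Letters are 1, …, n as in one-line notation, not 0, …, n - 1.
IsPermutation : Pred Word 0ℓ
IsPermutation w = w ↭ applyUpTo suc (length w)

infixr 6 _⊕_

_⊕_ : Word → Word → Word
ρ ⊕ τ = ρ ++ map (length ρ +_) τ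

Decomposable : Pred Word 0ℓ
Decomposable w = ∃[ ρ ] ∃[ τ ]
  IsPermutation ρ × IsPermutation τ × ρ ≢ [] × τ ≢ [] × w ≡ ρ ⊕ τ

Indecomposable : Pred Word 0ℓ
Indecomposable w = w ≢ [] × ¬ Decomposable w

Inversion : (w : Word) → Pred (Fin (length w) × Fin (length w)) 0ℓ
Inversion w (i , j) = i Fin.< j × lookup w i > lookup w j

inversion? : (w : Word) → Decidable (Inversion w)
inversion? w (i , j) = (i Fin.<? j) ×-dec (lookup w j <? lookup w i)

inversions : Word → ℕ
inversions w =
  length (filter (inversion? w)
    (cartesianProduct (allFin (length w)) (allFin (length w))))

-- f picks the positions i₁ < ⋯ < iₘ of an occurrence of τ in w.
Contains : Word → Word → Set
Contains w τ = Σ[ f ∈ (Fin (length τ) → Fin (length w)) ]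
  (∀ (a b : Fin (length τ)) → a Fin.< b → f a Fin.< f b) ×
  (∀ (a b : Fin (length τ)) →
     lookup w (f a) < lookup w (f b) ⇔ lookup τ a < lookup τ b)

Avoids : Word → Word → Set
Avoids w τ = ¬ Contains w τ

I : ℕ → List Word → Pred Word 0ℓ
I k τs w =
  IsPermutation w × Indecomposable w × inversions w ≡ k × All (Avoids w) τs

IsPartition : ℕ → Pred (List ℕ) 0ℓ
IsPartition k p = All (_> 0) p × Linked _≥_ p × sum p ≡ k

EqualPartsPartition : ℕ → Pred (List ℕ) 0ℓ
EqualPartsPartition k p = IsPartition k p × AllPairs _≡_ p

PositiveDivisor : ℕ → Pred ℕ 0ℓ
PositiveDivisor k d = d > 0 × d ∣ k

{-# OPTIONS --safe #-}
module Submission where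

-- For k ≥ 1 the permutations counted are exactly the words
--
--   block a r = (r + 1) (r + 2) ⋯ (r + a) 1 2 ⋯ r    with a * r = k,
--
-- so each is determined by the divisor r of k, just as a partition of k
-- into d equal parts is determined by the divisor d.
--
-- Such a word is easily seen to qualify: its inversions are the a * r
-- pairs made of one letter from each of its two increasing runs
-- (inversions-runs), it cannot be split as a sum because its first letter
-- exceeds its last (block-indecomposable), and a descent in it leads from
-- the first run to the second.  An occurrence of 321 would need two such
-- descents in a row; in an occurrence of 132 the letters 1 and 3 would both
-- lie in the first run and 2 in the second, although 2 exceeds 1
-- (block-avoids-321, block-avoids-132).
--
-- Conversely (I⇒block), let the largest letter n split a qualifying word
-- as L n R.  Avoiding 132 puts every letter of L above every letter of R,
-- and avoiding 321 makes R increasing.  If R is empty, then either L is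
-- empty and the word, being 1, has no inversion, or the word is L ⊕ 1.
-- Otherwise a descent in L followed by a letter of R would form 321, so L
-- is increasing too.  Then R L n is increasing, hence equal to 1 2 ⋯ n, and
-- the word L n R is a rotation of it, that is, a block.

open import Defs
open import Data.Empty using (⊥-elim)
open import Data.Fin.Base as Fin using (Fin)
open import Data.Fin.Patterns using (0F; 1F; 2F)
open import Data.List.Base using (List; []; _∷_; [_]; _++_; _∷ʳ_; map; length; lookup; filter; replicate; allFin; applyUpTo; cartesianProduct)
import Data.List.Properties as List
open import Data.List.Membership.Propositional using (_∈_)
open import Data.List.Membership.Propositional.Properties using (∈-lookup; ∈-++⁺ʳ; ∈-map⁺; ∈-map⁻; ∈-filter⁺; ∈-filter⁻; ∈-applyUpTo⁺; ∈-∃++)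
open import Data.List.Relation.Binary.Equality.Propositional using (≋⇒≡)
open import Data.List.Relation.Binary.Permutation.Propositional using (_↭_; ↭-refl; ↭-sym; ↭-trans; ↭-reflexive; ↭⇒↭ₛ)
open import Data.List.Relation.Binary.Permutation.Propositional.Properties using (∈-resp-↭; All-resp-↭; ↭-length; drop-mid; ++-comm)
import Data.List.Relation.Binary.Permutation.Setoid.Properties as Permutationₛ
open import Data.List.Relation.Binary.Sublist.Propositional using (_⊆_; []; _∷_; from∈; to∈; minimum) renaming (_∷ʳ_ to skip)
import Data.List.Relation.Binary.Sublist.Propositional.Properties as Sublist
open import Data.List.Relation.Unary.All as All using (All; []; _∷_)
import Data.List.Relation.Unary.All.Properties as All
open import Data.List.Relation.Unary.AllPairs as AllPairs using (AllPairs; []; _∷_)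
import Data.List.Relation.Unary.AllPairs.Properties as AllPairs
open import Data.List.Relation.Unary.Any using (here; there)
import Data.List.Relation.Unary.Linked.Properties as Linked
open import Data.List.Relation.Unary.Sorted.TotalOrder.Properties using (↗↭↗⇒≋; AllPairs⇒Sorted)
open import Data.List.Relation.Unary.Unique.Propositional using (Unique)
import Data.List.Relation.Unary.Unique.Propositional.Properties as Unique
open import Data.Nat.Base using (ℕ; zero; suc; _+_; _*_; _≤_; _<_; _>_; _≥_; s≤s; z<s; _/_; NonZero; >-nonZero; ≢-nonZero⁻¹)
open import Data.Nat.Divisibility using (_∣_; _∣?_; ∣⇒≤; divides)
open import Data.Nat.DivMod using (m*n/n≡m; m/n*n≡m)
open import Data.Nat.ListAction using (sum)
open import Data.Nat.Properties
open import Data.Product using (_×_; _,_; ∃-syntax; proj₁; proj₂)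
open import Data.Sum.Base using (_⊎_; inj₁; inj₂)
open import Function.Base using (_∘_; id; const)
open import Function.Bundles using (_⇔_; mk⇔; Equivalence)
open import Function.Construct.Composition using (_⇔-∘_)
open import Function.Construct.Identity using (⇔-id)
open import Level using (0ℓ)
open import Relation.Binary.Core using (Rel)
open import Relation.Binary.PropositionalEquality using (_≡_; _≢_; refl; sym; trans; cong; cong₂; subst; subst₂; setoid; module ≡-Reasoning)
open import Relation.Nullary using (¬_; yes; no; contradiction)
open import Relation.Unary using (Pred; Decidable)

private
  variable
    A B : Set

-- Lists and their sublists

++-injective : (xs xs′ : List A) {ys ys′ : List A} → length xs ≡ length xs′ →
               xs ++ ys ≡ xs′ ++ ys′ → xs ≡ xs′ × ys ≡ ys′
++-injective []       []         _ eq = refl , eq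
++-injective (x ∷ xs) (x′ ∷ xs′) l eq
  with xs≡ , ys≡ ← ++-injective xs xs′ (suc-injective l) (List.∷-injectiveʳ eq)
  = cong₂ _∷_ (List.∷-injectiveˡ eq) xs≡ , ys≡

∷-as-∷ʳ : (x : A) (xs : List A) → ∃[ ys ] ∃[ y ] x ∷ xs ≡ ys ∷ʳ y
∷-as-∷ʳ x []        = [] , x , refl
∷-as-∷ʳ x (x′ ∷ xs) with ys , y , eq ← ∷-as-∷ʳ x′ xs = x ∷ ys , y , cong (x ∷_) eq

sum-replicate : ∀ n x → sum (replicate n x) ≡ n * x
sum-replicate zero    x = refl
sum-replicate (suc n) x = cong (x +_) (sum-replicate n x)

module _ {R : Rel A 0ℓ} where

  AllPairs-replicate : ∀ n {x} → R x x → AllPairs R (replicate n x)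
  AllPairs-replicate zero    r = []
  AllPairs-replicate (suc n) r = All.replicate⁺ n r ∷ AllPairs-replicate n r

  AllPairs-lookup : ∀ {xs} → AllPairs R xs → ∀ i j → i Fin.< j →
                    R (lookup xs i) (lookup xs j)
  AllPairs-lookup (r ∷ rs) Fin.zero    (Fin.suc j) _         = All.lookup r (∈-lookup j)
  AllPairs-lookup (r ∷ rs) (Fin.suc i) (Fin.suc j) (s≤s i<j) = AllPairs-lookup rs i j i<j

  AllPairs-++⁻ : ∀ xs {ys} → AllPairs R (xs ++ ys) →
                 ∀ {x y} → x ∈ xs → y ∈ ys → R x y
  AllPairs-++⁻ (x ∷ xs) (r ∷ rs) (here refl) y∈ = All.lookup r (∈-++⁺ʳ xs y∈)
  AllPairs-++⁻ (x ∷ xs) (r ∷ rs) (there x∈)  y∈ = AllPairs-++⁻ xs rs x∈ y∈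

  -- Two-letter sublists are the pairs of entries at increasing positions.
  sublists⇒AllPairs : ∀ xs → (∀ {x y} → x ∷ y ∷ [] ⊆ xs → R x y) → AllPairs R xs
  sublists⇒AllPairs []       h = []
  sublists⇒AllPairs (x ∷ xs) h =
    All.tabulate (λ y∈ → h (refl ∷ from∈ y∈)) ∷ sublists⇒AllPairs xs (h ∘ skip x)

Unique-map : {P : Pred A 0ℓ} (f : A → B) →
             (∀ {x y} → P x → P y → f x ≡ f y → x ≡ y) →
             ∀ {xs} → All P xs → Unique xs → Unique (map f xs)
Unique-map f inj []       []       = []
Unique-map f inj (p ∷ ps) (u ∷ us) =
  All.map⁺ (All.zipWith (λ (q , x≢y) eq → x≢y (inj p q eq)) (ps , u))
  ∷ Unique-map f inj ps us

-- The identity permutation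

-- The word 1 2 ⋯ n.
oneTo : ℕ → Word
oneTo = applyUpTo suc

length-oneTo : ∀ n → length (oneTo n) ≡ n
length-oneTo = List.length-applyUpTo suc

applyUpTo-cong : {f g : ℕ → A} → (∀ i → f i ≡ g i) → ∀ n → applyUpTo f n ≡ applyUpTo g n
applyUpTo-cong h zero    = refl
applyUpTo-cong h (suc n) = cong₂ _∷_ (h 0) (applyUpTo-cong (h ∘ suc) n)

applyUpTo-+ : (f : ℕ → A) → ∀ m n →
              applyUpTo f (m + n) ≡ applyUpTo f m ++ applyUpTo (f ∘ (m +_)) n
applyUpTo-+ f zero    n = refl
applyUpTo-+ f (suc m) n = cong (f 0 ∷_) (applyUpTo-+ (f ∘ suc) m n)

oneTo-+ : ∀ m n → oneTo (m + n) ≡ oneTo m ++ map (m +_) (oneTo n)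
oneTo-+ m n = begin
  oneTo (m + n)                                ≡⟨ applyUpTo-+ suc m n ⟩
  oneTo m ++ applyUpTo (λ i → suc (m + i)) n   ≡⟨ cong (oneTo m ++_) (applyUpTo-cong (λ i → sym (+-suc m i)) n) ⟩
  oneTo m ++ applyUpTo (λ i → m + suc i) n     ≡⟨ cong (oneTo m ++_) (List.map-applyUpTo suc (m +_) n) ⟨
  oneTo m ++ map (m +_) (oneTo n)              ∎
  where open ≡-Reasoning

oneTo-≤ : ∀ n → All (_≤ n) (oneTo n)
oneTo-≤ n = All.applyUpTo⁺₁ suc n id

oneTo-> : ∀ n → All (_> 0) (oneTo n)
oneTo-> n = All.applyUpTo⁺₂ suc n (λ _ → z<s)

oneTo-increasing : ∀ n → AllPairs _<_ (oneTo n)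
oneTo-increasing n = AllPairs.applyUpTo⁺₁ suc n (λ i<j _ → s≤s i<j)

oneTo-unique : ∀ n → Unique (oneTo n)
oneTo-unique n = AllPairs.map <⇒≢ (oneTo-increasing n)

permutation-≤ : ∀ {w} → IsPermutation w → All (_≤ length w) w
permutation-≤ p = All-resp-↭ (↭-sym p) (oneTo-≤ _)

permutation-> : ∀ {w} → IsPermutation w → All (_> 0) w
permutation-> p = All-resp-↭ (↭-sym p) (oneTo-> _)

Unique-resp-↭ : {xs ys : List ℕ} → xs ↭ ys → Unique xs → Unique ys
Unique-resp-↭ = Permutationₛ.Unique-resp-↭ (setoid ℕ) ∘ ↭⇒↭ₛ

-- There is only one way to sort a word.
increasing-↭-≡ : {xs ys : List ℕ} → AllPairs _≤_ xs → AllPairs _≤_ ys → xs ↭ ys → xs ≡ ys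
increasing-↭-≡ xs↗ ys↗ p =
  ≋⇒≡ (↗↭↗⇒≋ ≤-totalOrder (AllPairs⇒Sorted ≤-totalOrder xs↗) (AllPairs⇒Sorted ≤-totalOrder ys↗) (↭⇒↭ₛ p))

-- Counting inversions

-- The number of entries of a list that satisfy P.
count : {P : Pred A 0ℓ} → Decidable P → List A → ℕ
count P? xs = length (filter P? xs)

count-++ : {P : Pred A 0ℓ} (P? : Decidable P) → ∀ xs ys →
           count P? (xs ++ ys) ≡ count P? xs + count P? ys
count-++ P? xs ys = trans (cong length (List.filter-++ P? xs ys)) (List.length-++ (filter P? xs))

count-map : {P : Pred A 0ℓ} {Q : Pred B 0ℓ} (P? : Decidable P) (Q? : Decidable Q) (f : A → B) →
            (∀ x → Q (f x) ⇔ P x) → ∀ xs → count Q? (map f xs) ≡ count P? xs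
count-map P? Q? f h []       = refl
count-map P? Q? f h (x ∷ xs) with Q? (f x) | P? x
... | yes _ | yes _ = cong suc (count-map P? Q? f h xs)
... | no  _ | no  _ = count-map P? Q? f h xs
... | yes q | no ¬p = contradiction (Equivalence.to (h x) q) ¬p
... | no ¬q | yes p = contradiction (Equivalence.from (h x) p) ¬q

allFin-suc : ∀ n → allFin (suc n) ≡ Fin.zero ∷ map Fin.suc (allFin n)
allFin-suc n = cong (Fin.zero ∷_) (sym (List.map-tabulate id Fin.suc))

-- The pairs (i , j) with i positive contribute the inversions of w, those
-- with i zero the letters of w smaller than x.
inversions-∷ : ∀ x w → inversions (x ∷ w) ≡ count (_<? x) w + inversions w
inversions-∷ x w = begin
  inversions (x ∷ w)
    ≡⟨ cong (λ is → count inv? (cartesianProduct is is)) (allFin-suc n) ⟩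
  count inv? (map (Fin.zero ,_) (Fin.zero ∷ map Fin.suc (allFin n)) ++ cartesianProduct (map Fin.suc (allFin n)) (Fin.zero ∷ map Fin.suc (allFin n)))
    ≡⟨ count-++ inv? (map (Fin.zero ,_) (Fin.zero ∷ map Fin.suc (allFin n))) _ ⟩
  count inv? (map (Fin.zero ,_) (Fin.zero ∷ map Fin.suc (allFin n))) + count inv? (cartesianProduct (map Fin.suc (allFin n)) (Fin.zero ∷ map Fin.suc (allFin n)))
    ≡⟨ cong₂ _+_ first-row (other-rows (allFin n)) ⟩
  count (_<? x) w + inversions w ∎
  where
  open ≡-Reasoning
  n = length w
  inv? = inversion? (x ∷ w)

  first-row : count inv? (map (Fin.zero ,_) (Fin.zero ∷ map Fin.suc (allFin n))) ≡ count (_<? x) w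
  first-row = begin
    count inv? (map (Fin.zero ,_) (map Fin.suc (allFin n)))
      ≡⟨ cong (count inv?) (List.map-∘ (allFin n)) ⟨
    count inv? (map (λ j → Fin.zero , Fin.suc j) (allFin n))
      ≡⟨ count-map (λ j → lookup w j <? x) inv? _ (λ j → mk⇔ proj₂ (z<s ,_)) (allFin n) ⟩
    count (λ j → lookup w j <? x) (allFin n)
      ≡⟨ count-map (λ j → lookup w j <? x) (_<? x) (lookup w) (λ j → ⇔-id _) (allFin n) ⟨
    count (_<? x) (map (lookup w) (allFin n))
      ≡⟨ cong (count (_<? x)) (trans (List.map-tabulate id (lookup w)) (List.tabulate-lookup w)) ⟩
    count (_<? x) w ∎

  row : ∀ i → count inv? (map (Fin.suc i ,_) (Fin.zero ∷ map Fin.suc (allFin n)))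
            ≡ count (inversion? w) (map (i ,_) (allFin n))
  row i = begin
    count inv? (map (Fin.suc i ,_) (map Fin.suc (allFin n)))
      ≡⟨ cong (count inv?) (trans (sym (List.map-∘ (allFin n))) (List.map-∘ (allFin n))) ⟩
    count inv? (map (λ (i , j) → Fin.suc i , Fin.suc j) (map (i ,_) (allFin n)))
      ≡⟨ count-map (inversion? w) inv? _ (λ _ → mk⇔ (λ { (s≤s i<j , gt) → i<j , gt }) (λ (i<j , gt) → s≤s i<j , gt)) (map (i ,_) (allFin n)) ⟩
    count (inversion? w) (map (i ,_) (allFin n)) ∎

  other-rows : ∀ is → count inv? (cartesianProduct (map Fin.suc is) (Fin.zero ∷ map Fin.suc (allFin n)))
                    ≡ count (inversion? w) (cartesianProduct is (allFin n))
  other-rows []       = refl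
  other-rows (i ∷ is) = begin
    count inv? (map (Fin.suc i ,_) js ++ cartesianProduct (map Fin.suc is) js)
      ≡⟨ count-++ inv? (map (Fin.suc i ,_) js) _ ⟩
    count inv? (map (Fin.suc i ,_) js) + count inv? (cartesianProduct (map Fin.suc is) js)
      ≡⟨ cong₂ _+_ (row i) (other-rows is) ⟩
    count (inversion? w) (map (i ,_) (allFin n)) + count (inversion? w) (cartesianProduct is (allFin n))
      ≡⟨ count-++ (inversion? w) (map (i ,_) (allFin n)) _ ⟨
    count (inversion? w) (map (i ,_) (allFin n) ++ cartesianProduct is (allFin n)) ∎
    where js = Fin.zero ∷ map Fin.suc (allFin n)

count-smaller : ∀ {x w} → All (x ≤_) w → count (_<? x) w ≡ 0
count-smaller x≤ = cong length (List.filter-none (_<? _) (All.map ≤⇒≯ x≤))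

inversions-increasing : ∀ {w} → AllPairs _≤_ w → inversions w ≡ 0
inversions-increasing []                 = refl
inversions-increasing {x ∷ w} (x≤ ∷ w↗) =
  trans (inversions-∷ x w) (cong₂ _+_ (count-smaller x≤) (inversions-increasing w↗))

-- Two increasing runs, every letter of the first exceeding every letter of
-- the second.
inversions-runs : ∀ {u v} → AllPairs _≤_ u → AllPairs _≤_ v → All (λ x → All (_< x) v) u →
                  inversions (u ++ v) ≡ length u * length v
inversions-runs                 []        v↗ []         = inversions-increasing v↗
inversions-runs {x ∷ u} {v} (x≤ ∷ u↗) v↗ (v< ∷ v<u) = begin
  inversions (x ∷ u ++ v)
    ≡⟨ inversions-∷ x (u ++ v) ⟩
  count (_<? x) (u ++ v) + inversions (u ++ v)
    ≡⟨ cong₂ _+_ (count-++ (_<? x) u v) (inversions-runs u↗ v↗ v<u) ⟩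
  count (_<? x) u + count (_<? x) v + length u * length v
    ≡⟨ cong₂ (λ s t → s + t + length u * length v) (count-smaller x≤) (cong length (List.filter-all (_<? x) v<)) ⟩
  length v + length u * length v ∎
  where open ≡-Reasoning

-- Pattern containment

-- The two forbidden patterns.
132′ 321′ : Word
132′ = 1 ∷ 3 ∷ 2 ∷ []
321′ = 3 ∷ 2 ∷ 1 ∷ []

Contains-trans : ∀ w {σ τ} → Contains w σ → Contains σ τ → Contains w τ
Contains-trans w (f , f-mono , f-iso) (g , g-mono , g-iso) =
  f ∘ g , (λ a b a<b → f-mono _ _ (g-mono a b a<b)) , (λ a b → g-iso a b ⇔-∘ f-iso (g a) (g b))

-- The positions in ys of the entries of a sublist xs.
embed : {xs ys : List A} → xs ⊆ ys → Fin (length xs) → Fin (length ys)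
embed (skip y s) i           = Fin.suc (embed s i)
embed (_ ∷ s)  Fin.zero    = Fin.zero
embed (_ ∷ s)  (Fin.suc i) = Fin.suc (embed s i)

embed-mono : {xs ys : List A} (s : xs ⊆ ys) → ∀ i j → i Fin.< j → embed s i Fin.< embed s j
embed-mono (skip y s) i           j           i<j       = s≤s (embed-mono s i j i<j)
embed-mono (_ ∷ s)  Fin.zero    (Fin.suc j) _         = z<s
embed-mono (_ ∷ s)  (Fin.suc i) (Fin.suc j) (s≤s i<j) = s≤s (embed-mono s i j i<j)

lookup-embed : {xs ys : List A} (s : xs ⊆ ys) → ∀ i → lookup ys (embed s i) ≡ lookup xs i
lookup-embed (skip y s) i           = lookup-embed s i
lookup-embed (refl ∷ s) Fin.zero    = refl
lookup-embed (_ ∷ s)    (Fin.suc i) = lookup-embed s i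

⊆⇒Contains : ∀ {w τ} → τ ⊆ w → Contains w τ
⊆⇒Contains s = embed s , embed-mono s , λ a b →
  mk⇔ (subst id (cong₂ _<_ (lookup-embed s a) (lookup-embed s b)))
      (subst id (sym (cong₂ _<_ (lookup-embed s a) (lookup-embed s b))))

both : {P Q : Set} → P → Q → P ⇔ Q
both p q = mk⇔ (const q) (const p)

neither : {P Q : Set} → ¬ P → ¬ Q → P ⇔ Q
neither ¬p ¬q = mk⇔ (⊥-elim ∘ ¬p) (⊥-elim ∘ ¬q)

contains-132 : ∀ {w x y z} → x ∷ y ∷ z ∷ [] ⊆ w → x < z → z < y → Contains w 132′
contains-132 {w} {x} {y} {z} s x<z z<y =
  Contains-trans w (⊆⇒Contains s) (id , (λ _ _ → id) , iso)
  where
  iso : ∀ a b → lookup (x ∷ y ∷ z ∷ []) a < lookup (x ∷ y ∷ z ∷ []) b ⇔ lookup 132′ a < lookup 132′ b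
  iso 0F 0F = neither (<-irrefl refl) (<-irrefl refl)
  iso 0F 1F = both (<-trans x<z z<y) (m<m+n 1 z<s)
  iso 0F 2F = both x<z (m<m+n 1 z<s)
  iso 1F 0F = neither (<-asym (<-trans x<z z<y)) (<-asym (m<m+n 1 z<s))
  iso 1F 1F = neither (<-irrefl refl) (<-irrefl refl)
  iso 1F 2F = neither (<-asym z<y) (<-asym (m<m+n 2 z<s))
  iso 2F 0F = neither (<-asym x<z) (<-asym (m<m+n 1 z<s))
  iso 2F 1F = both z<y (m<m+n 2 z<s)
  iso 2F 2F = neither (<-irrefl refl) (<-irrefl refl)

contains-321 : ∀ {w x y z} → x ∷ y ∷ z ∷ [] ⊆ w → y < x → z < y → Contains w 321′
contains-321 {w} {x} {y} {z} s y<x z<y =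
  Contains-trans w (⊆⇒Contains s) (id , (λ _ _ → id) , iso)
  where
  iso : ∀ a b → lookup (x ∷ y ∷ z ∷ []) a < lookup (x ∷ y ∷ z ∷ []) b ⇔ lookup 321′ a < lookup 321′ b
  iso 0F 0F = neither (<-irrefl refl) (<-irrefl refl)
  iso 0F 1F = neither (<-asym y<x) (<-asym (m<m+n 2 z<s))
  iso 0F 2F = neither (<-asym (<-trans z<y y<x)) (<-asym (m<m+n 1 z<s))
  iso 1F 0F = both y<x (m<m+n 2 z<s)
  iso 1F 1F = neither (<-irrefl refl) (<-irrefl refl)
  iso 1F 2F = neither (<-asym z<y) (<-asym (m<m+n 1 z<s))
  iso 2F 0F = both (<-trans z<y y<x) (m<m+n 1 z<s)
  iso 2F 1F = both z<y (m<m+n 1 z<s)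
  iso 2F 2F = neither (<-irrefl refl) (<-irrefl refl)

-- Block words

-- The word (r + 1) ⋯ (r + a) 1 ⋯ r.
block : ℕ → ℕ → Word
block a r = map (r +_) (oneTo a) ++ oneTo r

block-upper-> : ∀ a r → All (_> r) (map (r +_) (oneTo a))
block-upper-> a r = All.map⁺ (All.map (m<m+n r) (oneTo-> a))

block-upper-increasing : ∀ a r → AllPairs _<_ (map (r +_) (oneTo a))
block-upper-increasing a r = AllPairs.map⁺ (AllPairs.map (+-monoʳ-< r) (oneTo-increasing a))

block-permutation : ∀ a r → IsPermutation (block a r)
block-permutation a r =
  ↭-trans (++-comm (map (r +_) (oneTo a)) (oneTo r))
    (↭-reflexive (trans (sym (oneTo-+ r a)) (cong oneTo (sym length-block))))
  where
  open ≡-Reasoning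
  length-block : length (block a r) ≡ r + a
  length-block = begin
    length (block a r)                                     ≡⟨ List.length-++ (map (r +_) (oneTo a)) ⟩
    length (map (r +_) (oneTo a)) + length (oneTo r)       ≡⟨ cong₂ _+_ (trans (List.length-map (r +_) (oneTo a)) (length-oneTo a)) (length-oneTo r) ⟩
    a + r                                                  ≡⟨ +-comm a r ⟩
    r + a                                                  ∎

-- In a sum ρ ⊕ τ of non-empty permutations the first letter is at most the
-- length of ρ and the last letter is larger.
⊕-first<last : ∀ {ρ τ x u} v {z} → IsPermutation ρ → IsPermutation τ → ρ ≢ [] → τ ≢ [] →
               x ∷ u ≡ ρ ⊕ τ → v ∷ʳ z ≡ ρ ⊕ τ → x < z
⊕-first<last {[]}              _ _  _  ρ≢ _  _ _ = contradiction refl ρ≢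
⊕-first<last {_ ∷ _} {[]}      _ _  _  _  τ≢ _ _ = contradiction refl τ≢
⊕-first<last {p ∷ ρ} {t ∷ τ} v pρ pτ _ _ eq₁ eq₂
  with ys , y , eq ← ∷-as-∷ʳ t τ
  with refl ← List.∷-injectiveˡ eq₁
  with _ , refl ← List.∷ʳ-injective v ((p ∷ ρ) ++ map (length (p ∷ ρ) +_) ys)
         (trans eq₂ (trans (cong (λ l → (p ∷ ρ) ++ map (length (p ∷ ρ) +_) l) eq)
           (trans (cong ((p ∷ ρ) ++_) (List.map-++ (length (p ∷ ρ) +_) ys [ y ]))
             (sym (List.++-assoc (p ∷ ρ) (map (length (p ∷ ρ) +_) ys) _)))))
  = ≤-<-trans (All.head (permutation-≤ pρ))
      (m<m+n (length (p ∷ ρ)) (All.lookup (permutation-> pτ) (subst (y ∈_) (sym eq) (∈-++⁺ʳ ys (here refl)))))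

block-indecomposable : ∀ a r → Indecomposable (block (suc a) (suc r))
block-indecomposable a r = (λ ()) , λ (ρ , τ , pρ , pτ , ρ≢ , τ≢ , eq) →
  <-asym (⊕-first<last (map (suc r +_) (oneTo (suc a)) ++ oneTo r) pρ pτ ρ≢ τ≢ eq (trans (sym last-letter) eq)) (m<m+n (suc r) z<s)
  where
  last-letter : block (suc a) (suc r) ≡ (map (suc r +_) (oneTo (suc a)) ++ oneTo r) ∷ʳ suc r
  last-letter = trans (cong (map (suc r +_) (oneTo (suc a)) ++_) (sym (List.applyUpTo-∷ʳ suc r)))
    (sym (List.++-assoc (map (suc r +_) (oneTo (suc a))) (oneTo r) _))

block-inversions : ∀ a r → inversions (block a r) ≡ a * r
block-inversions a r = trans
  (inversions-runs (AllPairs.map <⇒≤ (block-upper-increasing a r)) (AllPairs.map <⇒≤ (oneTo-increasing r))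
    (All.map (λ r<x → All.map (λ y≤r → ≤-<-trans y≤r r<x) (oneTo-≤ r)) (block-upper-> a r)))
  (cong₂ _*_ (trans (List.length-map (r +_) (oneTo a)) (length-oneTo a)) (length-oneTo r))

-- How a letter x of a block relates to a later letter y: a descent goes
-- from the upper run to the lower one, and a letter of the upper run is
-- only preceded by letters of the upper run.
Precedes : ℕ → Rel ℕ 0ℓ
Precedes r x y = (x < y ⊎ (r < x × y ≤ r)) × (r < y → r < x)

block-precedes : ∀ a r → AllPairs (Precedes r) (block a r)
block-precedes a r = AllPairs.++⁺
  (upper (block-upper-> a r) (block-upper-increasing a r))
  (lower (oneTo-≤ r) (oneTo-increasing r))
  (All.map (λ r<x → All.map (λ y≤r → inj₂ (r<x , y≤r) , const r<x) (oneTo-≤ r)) (block-upper-> a r))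
  where
  upper : ∀ {u} → All (_> r) u → AllPairs _<_ u → AllPairs (Precedes r) u
  upper []        []        = []
  upper (r<x ∷ p) (x< ∷ u↗) = All.map (λ x<y → inj₁ x<y , const r<x) x< ∷ upper p u↗

  lower : ∀ {v} → All (_≤ r) v → AllPairs _<_ v → AllPairs (Precedes r) v
  lower []      []        = []
  lower (_ ∷ p) (x< ∷ v↗) =
    All.zipWith (λ (y≤r , x<y) → inj₁ x<y , λ r<y → contradiction y≤r (<⇒≱ r<y)) (p , x<) ∷ lower p v↗

descent-from : ∀ {r x y} → Precedes r x y → y < x → r < x
descent-from (inj₁ x<y , _)       y<x = contradiction x<y (<-asym y<x)
descent-from (inj₂ (r<x , _) , _) y<x = r<x

descent-to : ∀ {r x y} → Precedes r x y → y < x → y ≤ r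
descent-to (inj₁ x<y , _)       y<x = contradiction x<y (<-asym y<x)
descent-to (inj₂ (_ , y≤r) , _) y<x = y≤r

block-avoids-132 : ∀ a r → Avoids (block a r) 132′
block-avoids-132 a r (f , mono , iso) = <⇒≱ (<-trans r<x x<z) z≤r
  where
  x<z = Equivalence.from (iso 0F 2F) (m<m+n 1 z<s)
  z<y = Equivalence.from (iso 2F 1F) (m<m+n 2 z<s)
  xy  = AllPairs-lookup (block-precedes a r) _ _ (mono 0F 1F z<s)
  yz  = AllPairs-lookup (block-precedes a r) _ _ (mono 1F 2F (s≤s z<s))
  r<x = proj₂ xy (descent-from yz z<y)
  z≤r = descent-to yz z<y

block-avoids-321 : ∀ a r → Avoids (block a r) 321′
block-avoids-321 a r (f , mono , iso) = <⇒≱ (descent-from yz z<y) (descent-to xy y<x)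
  where
  y<x = Equivalence.from (iso 1F 0F) (m<m+n 2 z<s)
  z<y = Equivalence.from (iso 2F 1F) (m<m+n 1 z<s)
  xy  = AllPairs-lookup (block-precedes a r) _ _ (mono 0F 1F z<s)
  yz  = AllPairs-lookup (block-precedes a r) _ _ (mono 1F 2F (s≤s z<s))

-- Avoiders of 132 and 321

∷ʳ-max-decomposable : ∀ L m → L ↭ oneTo m → L ≢ [] → Decomposable (L ∷ʳ suc m)
∷ʳ-max-decomposable L m p L≢ =
  L , [ 1 ] , subst (λ l → L ↭ oneTo l) (sym |L|≡m) p , ↭-refl , L≢ , (λ ()) ,
  cong (L ∷ʳ_) (trans (+-comm 1 m) (cong (_+ 1) (sym |L|≡m)))
  where
  |L|≡m : length L ≡ m
  |L|≡m = trans (↭-length p) (length-oneTo m)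

-- If the increasing word 1 ⋯ m is v u, then u v is a block.
rotation-block : ∀ u v m → v ++ u ≡ oneTo m → u ++ v ≡ block (length u) (length v)
rotation-block u v m eq = cong₂ _++_ (proj₂ v,u≡) (proj₁ v,u≡)
  where
  m≡ : m ≡ length v + length u
  m≡ = trans (sym (length-oneTo m)) (trans (cong length (sym eq)) (List.length-++ v))

  v,u≡ : v ≡ oneTo (length v) × u ≡ map (length v +_) (oneTo (length u))
  v,u≡ = ++-injective v (oneTo (length v)) (sym (length-oneTo (length v)))
    (trans eq (trans (cong oneTo m≡) (oneTo-+ (length v) (length u))))

-- The word is written L n (y R) around its largest letter n = m + 1.
module _ (L : Word) (m y : ℕ) (R : Word)
         (perm : L ++ suc m ∷ y ∷ R ↭ oneTo (suc m))
         (no-132 : Avoids (L ++ suc m ∷ y ∷ R) 132′)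
         (no-321 : Avoids (L ++ suc m ∷ y ∷ R) 321′) where

  private
    others : L ++ y ∷ R ↭ oneTo m
    others = subst (L ++ y ∷ R ↭_) (List.++-identityʳ (oneTo m))
      (drop-mid L (oneTo m) (subst (L ++ suc m ∷ y ∷ R ↭_) (sym (List.applyUpTo-∷ʳ suc m)) perm))

    others≤m : All (_≤ m) L × All (_≤ m) (y ∷ R)
    others≤m = All.++⁻ L (All-resp-↭ (↭-sym others) (oneTo-≤ m))

    -- A smaller letter x of L before a larger letter z of y R would form
    -- 132 with n between them, and x and z are distinct.
    right<left : ∀ {x z} → x ∈ L → z ∈ y ∷ R → z < x
    right<left x∈ z∈ = ≤∧≢⇒< (≮⇒≥ ¬x<z)
      (AllPairs-++⁻ L (Unique-resp-↭ (↭-sym others) (oneTo-unique m)) x∈ z∈ ∘ sym)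
      where
      ¬x<z = λ x<z → no-132 (contains-132 (Sublist.++⁺ (from∈ x∈) (refl ∷ from∈ z∈))
        x<z (s≤s (All.lookup (proj₂ others≤m) z∈)))

    -- A descent to the right of n would form 321 with n.
    right-increasing : AllPairs _≤_ (y ∷ R)
    right-increasing = sublists⇒AllPairs (y ∷ R) λ {p} {q} s → ≮⇒≥ λ q<p →
      no-321 (contains-321 (Sublist.++⁺ (minimum L) (refl ∷ s))
        (s≤s (All.lookup (proj₂ others≤m) (to∈ s))) q<p)

    -- A descent to the left of n would form 321 with y.
    left-increasing : AllPairs _≤_ L
    left-increasing = sublists⇒AllPairs L λ {p} {q} s → ≮⇒≥ λ q<p →
      no-321 (contains-321 (Sublist.++⁺ s (skip (suc m) (refl ∷ minimum R)))
        q<p (right<left (to∈ (Sublist.∷ˡ⁻ s)) (here refl)))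

    rotated-increasing : AllPairs _≤_ ((y ∷ R) ++ L ∷ʳ suc m)
    rotated-increasing = AllPairs.++⁺ right-increasing
      (AllPairs.++⁺ left-increasing ([] ∷ []) (All.map (λ x≤m → m≤n⇒m≤1+n x≤m ∷ []) (proj₁ others≤m)))
      (All.tabulate λ z∈ → All.++⁺ (All.tabulate λ x∈ → <⇒≤ (right<left x∈ z∈))
        (m≤n⇒m≤1+n (All.lookup (proj₂ others≤m) z∈) ∷ []))

    rotated≡oneTo : (y ∷ R) ++ L ∷ʳ suc m ≡ oneTo (suc m)
    rotated≡oneTo = increasing-↭-≡ rotated-increasing (AllPairs.map <⇒≤ (oneTo-increasing (suc m)))
      (↭-trans (++-comm (y ∷ R) (L ∷ʳ suc m))
        (↭-trans (↭-reflexive (List.++-assoc L [ suc m ] (y ∷ R))) perm))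

  avoider-block : ∃[ a ] ∃[ r ] L ++ suc m ∷ y ∷ R ≡ block a r
  avoider-block = length (L ∷ʳ suc m) , length (y ∷ R) , trans (sym (List.++-assoc L [ suc m ] (y ∷ R)))
    (rotation-block (L ∷ʳ suc m) (y ∷ R) (suc m) rotated≡oneTo)

I⇒block : ∀ {k w} → k > 0 → I k (132′ ∷ 321′ ∷ []) w → ∃[ a ] ∃[ r ] w ≡ block a r
I⇒block {w = []}    _   (_ , (w≢ , _) , _) = contradiction refl w≢
I⇒block {w = c ∷ u} k>0 (perm , (_ , indec) , inv , no-132 ∷ no-321 ∷ []) =
  split (∈-∃++ (∈-resp-↭ (↭-sym perm) (∈-applyUpTo⁺ suc (n<1+n (length u)))))
  where
  split : ∃[ L ] ∃[ R ] c ∷ u ≡ L ++ suc (length u) ∷ R → ∃[ a ] ∃[ r ] c ∷ u ≡ block a r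
  split (L , y ∷ R , eq) =
    let a , r , eq′ = avoider-block L (length u) y R
          (subst (_↭ oneTo (suc (length u))) eq perm)
          (subst (λ w → Avoids w 132′) eq no-132) (subst (λ w → Avoids w 321′) eq no-321)
    in a , r , trans eq eq′
  -- A single letter has no inversion.
  split ([] , [] , eq) = contradiction (trans (sym inv) (cong inversions eq)) (>⇒≢ k>0)
  -- The largest letter comes last.
  split (L@(_ ∷ _) , [] , eq) = contradiction
    (subst Decomposable (sym eq) (∷ʳ-max-decomposable L (length u) L-perm λ ())) indec
    where
    L-perm : L ↭ oneTo (length u)
    L-perm = subst₂ _↭_ (List.++-identityʳ L) (List.++-identityʳ (oneTo (length u)))
      (drop-mid L (oneTo (length u)) (subst₂ _↭_ eq (sym (List.applyUpTo-∷ʳ suc (length u))) perm))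

-- Families indexed by divisors

divisors : ℕ → List ℕ
divisors k = filter (_∣? k) (oneTo k)

∈-divisors : ∀ k .{{_ : NonZero k}} → ∀ d → d ∈ divisors k ⇔ PositiveDivisor k d
∈-divisors k d = mk⇔ to from
  where
  to : d ∈ divisors k → PositiveDivisor k d
  to d∈ with d∈k , d∣k ← ∈-filter⁻ (_∣? k) {xs = oneTo k} d∈ = All.lookup (oneTo-> k) d∈k , d∣k

  from : PositiveDivisor k d → d ∈ divisors k
  from (s≤s _ , d∣k) = ∈-filter⁺ (_∣? k) (∈-applyUpTo⁺ suc (∣⇒≤ d∣k)) d∣k

divisors-unique : ∀ k → Unique (divisors k)
divisors-unique k = Unique.filter⁺ (_∣? k) (oneTo-unique k)

-- The quotient of k by d, with value 0 when d is 0.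
cofactor : ℕ → ℕ → ℕ
cofactor k zero      = 0
cofactor k d@(suc _) = k / d

cofactor-* : ∀ {k d} → PositiveDivisor k d → cofactor k d * d ≡ k
cofactor-* {d = suc _} (_ , d∣k) = m/n*n≡m d∣k

cofactor-unique : ∀ {k} .{{_ : NonZero k}} → ∀ q d → q * d ≡ k → PositiveDivisor k d × cofactor k d ≡ q
cofactor-unique {k} q zero    eq = contradiction (trans (sym eq) (*-zeroʳ q)) (≢-nonZero⁻¹ k)
cofactor-unique     q (suc d) eq = (z<s , divides q (sym eq)) , trans (cong (_/ suc d) (sym eq)) (m*n/n≡m q (suc d))

-- A set parametrised by the factorisations k = q * d, with different d
-- giving different elements, has as many elements as k has divisors.
factorisation-family :
  ∀ k .{{_ : NonZero k}} {Q : Pred B 0ℓ} (g : ℕ → ℕ → B) →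
  (∀ q d q′ d′ → q * d ≡ k → q′ * d′ ≡ k → g q d ≡ g q′ d′ → d ≡ d′) →
  (∀ y → Q y ⇔ (∃[ q ] ∃[ d ] q * d ≡ k × y ≡ g q d)) →
  HasCardinality Q (length (divisors k))
factorisation-family {B} k {Q} g inj char =
  map f (divisors k) ,
  Unique-map f (λ p p′ → inj _ _ _ _ (cofactor-* p) (cofactor-* p′))
    (All.tabulate (Equivalence.to (∈-divisors k _))) (divisors-unique k) ,
  (λ y → mk⇔ (Equivalence.from (char y) ∘ to y) (from y ∘ Equivalence.to (char y))) ,
  List.length-map f (divisors k)
  where
  f : ℕ → B
  f d = g (cofactor k d) d

  to : ∀ y → y ∈ map f (divisors k) → ∃[ q ] ∃[ d ] q * d ≡ k × y ≡ g q d
  to y y∈ with d , d∈ , eq ← ∈-map⁻ f y∈ = _ , d , cofactor-* (Equivalence.to (∈-divisors k d) d∈) , eq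

  from : ∀ y → ∃[ q ] ∃[ d ] q * d ≡ k × y ≡ g q d → y ∈ map f (divisors k)
  from y (q , d , q*d≡k , refl) with pd , refl ← cofactor-unique q d q*d≡k =
    ∈-map⁺ f (Equivalence.from (∈-divisors k d) pd)

-- Both a and r are positive here because their product is.
I-blocks : ∀ k .{{_ : NonZero k}} → ∀ w →
           I k (132′ ∷ 321′ ∷ []) w ⇔ (∃[ a ] ∃[ r ] a * r ≡ k × w ≡ block a r)
I-blocks k w = mk⇔ to from
  where
  to : I k (132′ ∷ 321′ ∷ []) w → ∃[ a ] ∃[ r ] a * r ≡ k × w ≡ block a r
  to i@(_ , _ , inv , _) with a , r , refl ← I⇒block (n≢0⇒n>0 (≢-nonZero⁻¹ k)) i =
    a , r , trans (sym (block-inversions a r)) inv , refl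

  from : ∃[ a ] ∃[ r ] a * r ≡ k × w ≡ block a r → I k (132′ ∷ 321′ ∷ []) w
  from (zero  , r     , eq , _)    = contradiction (sym eq) (≢-nonZero⁻¹ k)
  from (suc a , zero  , eq , _)    = contradiction (trans (sym eq) (*-zeroʳ a)) (≢-nonZero⁻¹ k)
  from (suc a , suc r , eq , refl) =
    block-permutation (suc a) (suc r) , block-indecomposable a r ,
    trans (block-inversions (suc a) (suc r)) eq ,
    block-avoids-132 (suc a) (suc r) ∷ block-avoids-321 (suc a) (suc r) ∷ []

-- The first letter of a non-trivial block is r + 1.
block-injective : ∀ k .{{_ : NonZero k}} → ∀ a r a′ r′ → a * r ≡ k → a′ * r′ ≡ k →
                  block a r ≡ block a′ r′ → r ≡ r′
block-injective k zero    r a′       r′ eq eq′ _ = contradiction (sym eq) (≢-nonZero⁻¹ k)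
block-injective k (suc a) r zero     r′ eq eq′ _ = contradiction (sym eq′) (≢-nonZero⁻¹ k)
block-injective k (suc a) r (suc a′) r′ _  _   h = +-cancelʳ-≡ 1 r r′ (List.∷-injectiveˡ h)

constant-replicate : ∀ {x : A} {xs} → All (x ≡_) xs → xs ≡ replicate (length xs) x
constant-replicate []         = refl
constant-replicate (refl ∷ h) = cong (_ ∷_) (constant-replicate h)

equalParts-replicate : ∀ k .{{_ : NonZero k}} → ∀ p →
                       EqualPartsPartition k p ⇔ (∃[ q ] ∃[ d ] q * d ≡ k × p ≡ replicate d q)
equalParts-replicate k p = mk⇔ to from
  where
  to : ∀ {p} → EqualPartsPartition k p → ∃[ q ] ∃[ d ] q * d ≡ k × p ≡ replicate d q
  to {[]}    ((_ , _ , sum≡k) , _)       = contradiction (sym sum≡k) (≢-nonZero⁻¹ k)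
  to {x ∷ p} ((_ , _ , sum≡k) , x≡ ∷ _) = x , suc (length p) , eq , p≡
    where
    p≡ : x ∷ p ≡ replicate (suc (length p)) x
    p≡ = cong (x ∷_) (constant-replicate x≡)
    eq : x * suc (length p) ≡ k
    eq = trans (*-comm x (suc (length p)))
      (trans (sym (sum-replicate (suc (length p)) x)) (trans (cong sum (sym p≡)) sum≡k))

  from : ∀ {p} → ∃[ q ] ∃[ d ] q * d ≡ k × p ≡ replicate d q → EqualPartsPartition k p
  from (zero  , d , eq , _)    = contradiction (sym eq) (≢-nonZero⁻¹ k)
  from (q@(suc _) , d , eq , refl) =
    ( All.replicate⁺ d z<s
    , Linked.AllPairs⇒Linked (AllPairs-replicate d ≤-refl)
    , trans (sum-replicate d q) (trans (*-comm d q) eq))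
    , AllPairs-replicate d refl

replicate-injective : ∀ {q q′ : A} d d′ → replicate d q ≡ replicate d′ q′ → d ≡ d′
replicate-injective d d′ eq =
  trans (sym (List.length-replicate d)) (trans (cong length eq) (List.length-replicate d′))

theorem19 : ∀ (k : ℕ) → k ≥ 1 → ∃[ n ] HasCardinality (I k ((1 ∷ 3 ∷ 2 ∷ []) ∷ (3 ∷ 2 ∷ 1 ∷ []) ∷ [])) n × HasCardinality (EqualPartsPartition k) n × HasCardinality (PositiveDivisor k) n
theorem19 k k≥1 =
  length (divisors k) ,
  factorisation-family k block (block-injective k) (I-blocks k) ,
  factorisation-family k (λ q d → replicate d q)
    (λ _ d _ d′ _ _ → replicate-injective d d′) (equalParts-replicate k) ,
  (divisors k , divisors-unique k , ∈-divisors k , refl)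
  where
  instance
    k≢0 : NonZero k
    k≢0 = >-nonZero k≥1
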